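{- Let $\mathbb K=(G,M,I)$ be a context. Then $(\mathtt{SC}^{left}/\!\equiv^{left},\wedge,\neg,[(\bot_{s_1},\boxminus_{\mathfrak o}\bot_{s_1})])$ and $(\mathtt{SC}^{right}/\!\equiv^{right},\vee,\neg,[(\boxminus_{\mathfrak p}\bot_{s_2},\bot_{s_2})])$ are both Boolean algebras, where in the first structure $\wedge$ is the meet, $\neg$ the complement and the constant is the least element, and in the second $\vee$ is the join, $\neg$ the complement and the constant is the greatest element (the remaining lattice operation being obtained by De Morgan duality).
   Context: Language. There are two sorts $s_1,s_2$, with disjoint nonempty sets of propositional variables $P_{s_1},P_{s_2}$. $\mathrm{Fm}_1$ (sort $s_1$) and $\mathrm{Fm}_2$ (sort $s_2$) are defined by simultaneous induction: $\varphi ::= p\mid \neg\varphi\mid\varphi\wedge\varphi\mid \Box_{\mathfrak p}\psi\mid \boxminus_{\mathfrak p}\psi$ ($p\in P_{s_1}$, $\psi\in\mathrm{Fm}_2$) and $\psi::= q\mid\neg\psi\mid\psi\wedge\psi\mid\Box_{\mathfrak o}\varphi\mid\boxminus_{\mathfrak o}\varphi$ ($q\in P_{s_2}$, $\varphi\in\mathrm{Fm}_1$). Other Boolean connectives are the usual abbreviations; $\bot_{s_i}$ is falsum of sort $s_i$. Semantics. A context is $\mathbb K=(G,M,I)$ with $G,M$ sets and $I\subseteq G\times M$. A $\mathbb K$-based model is $\mathfrak M=(G,M,I,v)$, where $v$ assigns to each $p\in P_{s_1}$ a subset of $G$ and to each $q\in P_{s_2}$ a subset of $M$. Sort-$s_1$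 formulas are evaluated at $g\in G$, sort-$s_2$ formulas at $m\in M$: variables by $v$, Boolean connectives classically, and: $g\models\Box_{\mathfrak p}\psi$ iff for all $m$, $Igm$ implies $m\models\psi$; $m\models\Box_{\mathfrak o}\varphi$ iff for all $g$, $Igm$ implies $g\models\varphi$; $g\models\boxminus_{\mathfrak p}\psi$ iff for all $m$, $m\models\psi$ implies $Igm$; $m\models\boxminus_{\mathfrak o}\varphi$ iff for all $g$, $g\models\varphi$ implies $Igm$. Write $\models^{\mathfrak C_{\mathbb K}}_{s_i}\chi$ if the sort-$s_i$ formula $\chi$ holds at all points of sort $s_i$ in all $\mathbb K$-based models. Semiconcepts. A pair $(\varphi,\psi)\in\mathrm{Fm}_1\times\mathrm{Fm}_2$ is a left semiconcept if $\models^{\mathfrak C_{\mathbb K}}_{s_2}\boxminus_{\mathfrak o}\varphi\leftrightarrow\psi$, and a right semiconcept if $\models^{\mathfrak C_{\mathbb K}}_{s_1}\varphi\leftrightarrow\boxminus_{\mathfrak p}\psi$; the sets of these are $\mathtt{SC}^{left}$ and $\mathtt{SC}^{right}$. On $\mathtt{SC}^{left}$, $(\varphi_1,\psi_1)\equiv^{left}(\varphi_2,\psi_2)$ iff $\models^{\mathfrak C_{\mathbb K}}_{s_1}\varphi_1\leftrightarrow\varphi_2$; on $\mathtt{SC}^{right}$, $(\varphi_1,\psi_1)\equiv^{right}(\varphi_2,\psi_2)$ iff $\models^{\mathfrak C_{\mathbb K}}_{s_2}\psi_1\leftrightarrow\psi_2$. $[\cdot]$ denotes equivalence classes. On $\mathtt{SC}^{left}/\!\equiv^{left}$: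 $[(\varphi,\psi)]\wedge[(\varphi',\psi')]:=[(\varphi\wedge\varphi',\boxminus_{\mathfrak o}(\varphi\wedge\varphi'))]$, $\neg[(\varphi,\psi)]:=[(\neg\varphi,\boxminus_{\mathfrak o}\neg\varphi)]$. On $\mathtt{SC}^{right}/\!\equiv^{right}$: $[(\varphi,\psi)]\vee[(\varphi',\psi')]:=[(\boxminus_{\mathfrak p}(\psi\wedge\psi'),\psi\wedge\psi')]$, $\neg[(\varphi,\psi)]:=[(\boxminus_{\mathfrak p}\neg\psi,\neg\psi)]$. -}

module Defs where

open import Level using (Level; _⊔_; suc)
open import Data.Product using (Σ; _×_; _,_)
open import Relation.Binary.Core using (Rel; REL)
open import Relation.Nullary.Negation using (¬_)
open import Relation.Unary using (Pred)

data Sort : Set where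
  s₁ s₂ : Sort

-- The two disjoint sets of variables are the two fibres of a family over
-- Sort; formulas of the two sorts form one inductive family.
data Fm {p : Level} (P : Sort → Set p) : Sort → Set p where
  var  : ∀ {s} → P s → Fm P s
  ∼_   : ∀ {s} → Fm P s → Fm P s
  _&_  : ∀ {s} → Fm P s → Fm P s → Fm P s
  □ₚ_  : Fm P s₂ → Fm P s₁
  ⊟ₚ_  : Fm P s₂ → Fm P s₁
  □ₒ_  : Fm P s₁ → Fm P s₂
  ⊟ₒ_  : Fm P s₁ → Fm P s₂

infix  8 ∼_ □ₚ_ ⊟ₚ_ □ₒ_ ⊟ₒ_
infixr 7 _&_
infixr 6 _⊃_
infix  5 _⇔_

-- ¬ and ∧ are the only primitive connectives.
_⊃_ : ∀ {p} {P : Sort → Set p} {s} → Fm P s → Fm P s → Fm P s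
χ ⊃ θ = ∼ (χ & ∼ θ)

_⇔_ : ∀ {p} {P : Sort → Set p} {s} → Fm P s → Fm P s → Fm P s
χ ⇔ θ = (χ ⊃ θ) & (θ ⊃ χ)

-- Falsum is not primitive either: it abbreviates a contradiction in a given
-- variable, which exists because the sets of variables are nonempty.
falsum : ∀ {p} {P : Sort → Set p} {s} → P s → Fm P s
falsum x = var x & ∼ var x

record Context (ℓ : Level) : Set (suc ℓ) where
  field
    G : Set ℓ
    M : Set ℓ
    I : REL G M ℓ

module Semantics {p ℓ : Level} (P : Sort → Set p) (K : Context ℓ) where
  open Context K

  Point : Sort → Set ℓ
  Point s₁ = G
  Point s₂ = M

  -- A K-based model is K together with a valuation.
  Valuation : Set (p ⊔ suc ℓ)
  Valuation = ∀ s → P s → Pred (Point s) ℓ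

  infix 4 _,_⊨_
  _,_⊨_ : ∀ {s} → Valuation → Point s → Fm P s → Set ℓ
  _,_⊨_ {s} v x (var y) = v s y x
  v , x ⊨ ∼ χ           = ¬ (v , x ⊨ χ)
  v , x ⊨ χ & θ         = (v , x ⊨ χ) × (v , x ⊨ θ)
  v , g ⊨ □ₚ ψ          = ∀ (m : M) → I g m → v , m ⊨ ψ
  v , g ⊨ ⊟ₚ ψ          = ∀ (m : M) → v , m ⊨ ψ → I g m
  v , m ⊨ □ₒ φ          = ∀ (g : G) → I g m → v , g ⊨ φ
  v , m ⊨ ⊟ₒ φ          = ∀ (g : G) → v , g ⊨ φ → I g m

  Valid : ∀ {s} → Fm P s → Set (p ⊔ suc ℓ)
  Valid {s} χ = ∀ (v : Valuation) (x : Point s) → v , x ⊨ χ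

  ⇔-refl : ∀ {s} (χ : Fm P s) → Valid (χ ⇔ χ)
  ⇔-refl χ v x = (λ (a , na) → na a) , (λ (a , na) → na a)

-- The quotients by ≡ˡ and ≡ʳ are represented as setoids: the carriers are the
-- sets of semiconcepts, and ≡ˡ and ≡ʳ play the role of equality.  The argument
-- P₀ picks the variables used for falsum.
module Semiconcepts {p ℓ : Level} (P : Sort → Set p) (P₀ : ∀ s → P s)
                    (K : Context ℓ) where
  open Semantics P K public

  IsLeftSemiconcept : Fm P s₁ × Fm P s₂ → Set (p ⊔ suc ℓ)
  IsLeftSemiconcept (φ , ψ) = Valid (⊟ₒ φ ⇔ ψ)

  IsRightSemiconcept : Fm P s₁ × Fm P s₂ → Set (p ⊔ suc ℓ)
  IsRightSemiconcept (φ , ψ) = Valid (φ ⇔ ⊟ₚ ψ)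

  SCˡ : Set (p ⊔ suc ℓ)
  SCˡ = Σ (Fm P s₁ × Fm P s₂) IsLeftSemiconcept

  SCʳ : Set (p ⊔ suc ℓ)
  SCʳ = Σ (Fm P s₁ × Fm P s₂) IsRightSemiconcept

  infix 4 _≡ˡ_ _≡ʳ_

  _≡ˡ_ : Rel SCˡ (p ⊔ suc ℓ)
  ((φ₁ , _) , _) ≡ˡ ((φ₂ , _) , _) = Valid (φ₁ ⇔ φ₂)

  _≡ʳ_ : Rel SCʳ (p ⊔ suc ℓ)
  ((_ , ψ₁) , _) ≡ʳ ((_ , ψ₂) , _) = Valid (ψ₁ ⇔ ψ₂)

  left : Fm P s₁ → SCˡ
  left φ = (φ , ⊟ₒ φ) , ⇔-refl (⊟ₒ φ)

  right : Fm P s₂ → SCʳ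
  right ψ = (⊟ₚ ψ , ψ) , ⇔-refl (⊟ₚ ψ)

  infixr 7 _∧ˡ_ _∧ʳ_
  infixr 6 _∨ˡ_ _∨ʳ_
  infix  8 ¬ˡ_ ¬ʳ_

  _∧ˡ_ : SCˡ → SCˡ → SCˡ
  ((φ , _) , _) ∧ˡ ((φ′ , _) , _) = left (φ & φ′)

  ¬ˡ_ : SCˡ → SCˡ
  ¬ˡ ((φ , _) , _) = left (∼ φ)

  ⊥ˡ : SCˡ
  ⊥ˡ = left (falsum (P₀ s₁))

  _∨ˡ_ : SCˡ → SCˡ → SCˡ
  x ∨ˡ y = ¬ˡ (¬ˡ x ∧ˡ ¬ˡ y)

  ⊤ˡ : SCˡ
  ⊤ˡ = ¬ˡ ⊥ˡ

  -- On the right the order is reversed: the join is conjunction of second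
  -- components, and the class of falsum is the greatest element.
  _∨ʳ_ : SCʳ → SCʳ → SCʳ
  ((_ , ψ) , _) ∨ʳ ((_ , ψ′) , _) = right (ψ & ψ′)

  ¬ʳ_ : SCʳ → SCʳ
  ¬ʳ ((_ , ψ) , _) = right (∼ ψ)

  ⊤ʳ : SCʳ
  ⊤ʳ = right (falsum (P₀ s₂))

  _∧ʳ_ : SCʳ → SCʳ → SCʳ
  x ∧ʳ y = ¬ʳ (¬ʳ x ∨ʳ ¬ʳ y)

  ⊥ʳ : SCʳ
  ⊥ʳ = ¬ʳ ⊤ʳ

{-# OPTIONS --safe #-}
-- Validity of χ ⇔ θ is mutual entailment, so formulas of one sort modulo valid
-- equivalence form a lattice under entailment, and excluded middle makes it
-- Boolean.  A left semiconcept is determined up to ≡ˡ by its first component,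
-- a right one up to ≡ʳ by its second, and these projections turn the operations
-- into the connectives.  On the right the order is reversed, so there the
-- algebra is the dual one.
module Submission where

open import Defs
open import Level using (Level)
open import Data.Product using (_×_; _,_; proj₁; proj₂)
open import Function.Base using (id; _∘_)
open import Axiom.ExcludedMiddle using (ExcludedMiddle)
open import Axiom.DoubleNegationElimination using (em⇒dne)
open import Algebra.Lattice.Bundles using (BooleanAlgebra; RawLattice)
open import Algebra.Lattice.Structures
  using (IsBooleanAlgebra; IsDistributiveLattice)
open import Algebra.Lattice.Structures.Biased using (isBooleanAlgebraʳ)
open import Algebra.Lattice.Morphism.Structures using (IsLatticeMonomorphism)
import Algebra.Lattice.Morphism.LatticeMonomorphism as LatticeMonomorphism
import Algebra.Lattice.Properties.BooleanAlgebra as BooleanAlgebraProperties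
open import Relation.Binary.Core using (Rel)
open import Relation.Binary.Structures using (IsPartialOrder)
import Relation.Binary.Lattice as Order
import Relation.Binary.Lattice.Properties.DistributiveLattice
  as DistributiveLatticeProperties
import Relation.Binary.Lattice.Properties.Lattice as LatticeProperties
open import Relation.Nullary.Negation using (contradiction; contraposition)

module FormulaAlgebra {p ℓ : Level} (em : ExcludedMiddle ℓ) (P : Sort → Set p)
                      (K : Context ℓ) (s : Sort) where
  open Semantics P K

  infix 4 _≈_ _≤_

  _≈_ : Rel (Fm P s) _
  χ ≈ θ = Valid (χ ⇔ θ)

  -- Entailment uses the function arrow at each point instead of validity of `χ ⊃ θ`, which unfolds
  -- to a negated conjunction; lattice laws then become plain pointwise arguments.
  _≤_ : Rel (Fm P s) _
  χ ≤ θ = ∀ (v : Valuation) (x : Point s) → v , x ⊨ χ → v , x ⊨ θ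

  infixr 6 _∥_

  -- The De Morgan form matches `_∨ˡ_` and `_∧ʳ_`, so the projections below preserve these
  -- operations by computation.
  _∥_ : Fm P s → Fm P s → Fm P s
  χ ∥ θ = ∼ (∼ χ & ∼ θ)

  ≤⇒⊃ : ∀ {χ θ} → χ ≤ θ → Valid (χ ⊃ θ)
  ≤⇒⊃ χ≤θ v x (a , ¬b) = ¬b (χ≤θ v x a)

  -- Where `χ` holds, `χ ⊃ θ` only refutes the failure of `θ`; excluded middle removes the double
  -- negation.
  ⊃⇒≤ : ∀ {χ θ} → Valid (χ ⊃ θ) → χ ≤ θ
  ⊃⇒≤ χ⊃θ v x a = em⇒dne em λ ¬b → χ⊃θ v x (a , ¬b)

  ≤-antisym : ∀ {χ θ} → χ ≤ θ → θ ≤ χ → χ ≈ θ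
  ≤-antisym {χ} {θ} χ≤θ θ≤χ v x =
    ≤⇒⊃ {χ} {θ} χ≤θ v x , ≤⇒⊃ {θ} {χ} θ≤χ v x

  ≈⇒≤ : ∀ {χ θ} → χ ≈ θ → χ ≤ θ
  ≈⇒≤ {χ} {θ} χ≈θ = ⊃⇒≤ {χ} {θ} λ v x → proj₁ (χ≈θ v x)

  ≈⇒≥ : ∀ {χ θ} → χ ≈ θ → θ ≤ χ
  ≈⇒≥ {χ} {θ} χ≈θ = ⊃⇒≤ {θ} {χ} λ v x → proj₂ (χ≈θ v x)

  ≤-isPartialOrder : IsPartialOrder _≈_ _≤_
  ≤-isPartialOrder = record
    { isPreorder = record
      { isEquivalence = record
        { refl  = λ {χ} → ⇔-refl χ
        ; sym   = λ {χ} {θ} χ≈θ →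
                    ≤-antisym {θ} {χ} (≈⇒≥ {χ} {θ} χ≈θ) (≈⇒≤ {χ} {θ} χ≈θ)
        ; trans = λ {χ} {θ} {ξ} χ≈θ θ≈ξ → ≤-antisym {χ} {ξ}
                    (λ v x → ≈⇒≤ {θ} {ξ} θ≈ξ v x ∘ ≈⇒≤ {χ} {θ} χ≈θ v x)
                    (λ v x → ≈⇒≥ {χ} {θ} χ≈θ v x ∘ ≈⇒≥ {θ} {ξ} θ≈ξ v x)
        }
      ; reflexive = λ {χ} {θ} → ≈⇒≤ {χ} {θ}
      ; trans     = λ χ≤θ θ≤ξ v x → θ≤ξ v x ∘ χ≤θ v x
      }
    ; antisym = λ {χ} {θ} → ≤-antisym {χ} {θ}
    }

  ∥-supremum : Order.Supremum _≤_ _∥_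
  ∥-supremum χ θ =
      (λ v x a (¬a , _) → ¬a a)
    , (λ v x b (_ , ¬b) → ¬b b)
    -- A De Morgan disjunction allows no case split: if `ξ` failed, both disjuncts would fail.
    , (λ ξ χ≤ξ θ≤ξ v x a∨b → em⇒dne em λ ¬c →
         a∨b (contraposition (χ≤ξ v x) ¬c , contraposition (θ≤ξ v x) ¬c))

  &-infimum : Order.Infimum _≤_ _&_
  &-infimum χ θ =
      (λ v x → proj₁)
    , (λ v x → proj₂)
    , (λ ξ ξ≤χ ξ≤θ v x c → ξ≤χ v x c , ξ≤θ v x c)

  ≤-lattice : Order.Lattice _ _ _
  ≤-lattice = record
    { _≈_ = _≈_ ; _≤_ = _≤_ ; _∨_ = _∥_ ; _∧_ = _&_
    ; isLattice = record
      { isPartialOrder = ≤-isPartialOrder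
      ; supremum       = ∥-supremum
      ; infimum        = &-infimum
      }
    }

  ≤-distributiveLattice : Order.DistributiveLattice _ _ _
  ≤-distributiveLattice = record
    { _≈_ = _≈_ ; _≤_ = _≤_ ; _∨_ = _∥_ ; _∧_ = _&_
    ; isDistributiveLattice = record
      { isLattice    = Order.Lattice.isLattice ≤-lattice
      ; ∧-distribˡ-∨ = λ χ θ ξ →
          ≤-antisym {χ & (θ ∥ ξ)} {(χ & θ) ∥ (χ & ξ)}
            (λ v x (a , b∨c) (¬ab , ¬ac) →
               b∨c ((λ b → ¬ab (a , b)) , (λ c → ¬ac (a , c))))
            (λ v x ab∨ac →
                 -- Both disjuncts contain `χ`, so its failure would refute both. The second
                 -- component is itself a negation and is proved directly.
                 em⇒dne em (λ ¬a → ab∨ac (¬a ∘ proj₁ , ¬a ∘ proj₁))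
               , λ (¬b , ¬c) → ab∨ac (¬b ∘ proj₂ , ¬c ∘ proj₂))
      }
    }

  isDistributiveLattice : IsDistributiveLattice _≈_ _∥_ _&_
  isDistributiveLattice = record
    { isLattice   = LatticeProperties.isAlgLattice ≤-lattice
    ; ∨-distrib-∧ = ∨-distrib-∧
    ; ∧-distrib-∨ = ∧-distrib-∨
    }
    where open DistributiveLatticeProperties ≤-distributiveLattice

  booleanAlgebra : P s → BooleanAlgebra _ _
  booleanAlgebra y = record
    { _≈_ = _≈_ ; _∨_ = _∥_ ; _∧_ = _&_ ; ¬_ = ∼_ ; ⊤ = ∼ falsum y ; ⊥ = falsum y
    ; isBooleanAlgebra = isBooleanAlgebraʳ record
      { isDistributiveLattice = isDistributiveLattice
      ; ∨-complementʳ = λ χ → ≤-antisym {χ ∥ ∼ χ} {∼ falsum y}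
          -- Both sides negate a contradictory conjunction, so each holds outright.
          (λ v x _ (a , ¬a) → ¬a a)
          (λ v x _ (¬a , ¬¬a) → ¬¬a ¬a)
      ; ∧-complementʳ = λ χ → ≤-antisym {χ & ∼ χ} {falsum y}
          (λ v x (a , ¬a) → contradiction a ¬a)
          (λ v x (a , ¬a) → contradiction a ¬a)
      ; ¬-cong = λ {χ} {θ} χ≈θ → ≤-antisym {∼ χ} {∼ θ}
          (λ v x → contraposition (≈⇒≥ {χ} {θ} χ≈θ v x))
          (λ v x → contraposition (≈⇒≤ {χ} {θ} χ≈θ v x))
      }
    }

theorem5p1 : ∀ {p ℓ : Level} → ExcludedMiddle ℓ →
    (P : Sort → Set p) (P₀ : ∀ s → P s) (K : Context ℓ) →
    let open Semiconcepts P P₀ K in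
    IsBooleanAlgebra _≡ˡ_ _∨ˡ_ _∧ˡ_ ¬ˡ_ ⊤ˡ ⊥ˡ ×
    IsBooleanAlgebra _≡ʳ_ _∨ʳ_ _∧ʳ_ ¬ʳ_ ⊤ʳ ⊥ʳ
theorem5p1 em P P₀ K = left-isBooleanAlgebra , right-isBooleanAlgebra
  where
  open Semiconcepts P P₀ K

  Bˡ Bʳ : BooleanAlgebra _ _
  Bˡ = FormulaAlgebra.booleanAlgebra em P K s₁ (P₀ s₁)
  -- Dualising makes `_&_` the join, `_∥_` the meet and falsum the greatest element.
  Bʳ = BooleanAlgebraProperties.∧-∨-booleanAlgebra
         (FormulaAlgebra.booleanAlgebra em P K s₂ (P₀ s₂))

  module Bˡ = BooleanAlgebra Bˡ
  module Bʳ = BooleanAlgebra Bʳ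

  rawLatticeˡ rawLatticeʳ : RawLattice _ _
  rawLatticeˡ = record { _≈_ = _≡ˡ_ ; _∧_ = _∧ˡ_ ; _∨_ = _∨ˡ_ }
  rawLatticeʳ = record { _≈_ = _≡ʳ_ ; _∧_ = _∧ʳ_ ; _∨_ = _∨ʳ_ }

  fst : SCˡ → Fm P s₁
  fst ((φ , _) , _) = φ

  snd : SCʳ → Fm P s₂
  snd ((_ , ψ) , _) = ψ

  -- `≡ˡ` is by definition equivalence of first components, so `fst` both preserves and reflects
  -- equality by the identity.
  fst-isLatticeMonomorphism : IsLatticeMonomorphism rawLatticeˡ Bˡ.rawLattice fst
  fst-isLatticeMonomorphism = record
    { isLatticeHomomorphism = record
      { isRelHomomorphism = record { cong = id }
      ; ∧-homo = λ x y → Bˡ.refl {fst (x ∧ˡ y)}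
      ; ∨-homo = λ x y → Bˡ.refl {fst (x ∨ˡ y)}
      }
    ; injective = id
    }

  snd-isLatticeMonomorphism : IsLatticeMonomorphism rawLatticeʳ Bʳ.rawLattice snd
  snd-isLatticeMonomorphism = record
    { isLatticeHomomorphism = record
      { isRelHomomorphism = record { cong = id }
      ; ∧-homo = λ x y → Bʳ.refl {snd (x ∧ʳ y)}
      ; ∨-homo = λ x y → Bʳ.refl {snd (x ∨ʳ y)}
      }
    ; injective = id
    }

  left-isBooleanAlgebra : IsBooleanAlgebra _≡ˡ_ _∨ˡ_ _∧ˡ_ ¬ˡ_ ⊤ˡ ⊥ˡ
  left-isBooleanAlgebra = record
    -- The monomorphism pulls back the lattice laws; the laws for the complement hold as they stand,
    -- since `fst` computes on `¬ˡ_`, `⊤ˡ` and `⊥ˡ`.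
    { isDistributiveLattice = LatticeMonomorphism.isDistributiveLattice
        fst-isLatticeMonomorphism Bˡ.isDistributiveLattice
    ; ∨-complement = Bˡ.∨-complementˡ ∘ fst , Bˡ.∨-complementʳ ∘ fst
    ; ∧-complement = Bˡ.∧-complementˡ ∘ fst , Bˡ.∧-complementʳ ∘ fst
    ; ¬-cong       = λ {x} {y} → Bˡ.¬-cong {fst x} {fst y}
    }

  right-isBooleanAlgebra : IsBooleanAlgebra _≡ʳ_ _∨ʳ_ _∧ʳ_ ¬ʳ_ ⊤ʳ ⊥ʳ
  right-isBooleanAlgebra = record
    { isDistributiveLattice = LatticeMonomorphism.isDistributiveLattice
        snd-isLatticeMonomorphism Bʳ.isDistributiveLattice
    ; ∨-complement = Bʳ.∨-complementˡ ∘ snd , Bʳ.∨-complementʳ ∘ snd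
    ; ∧-complement = Bʳ.∧-complementˡ ∘ snd , Bʳ.∧-complementʳ ∘ snd
    ; ¬-cong       = λ {x} {y} → Bʳ.¬-cong {snd x} {snd y}
    }
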